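{- If $\Delta;\Gamma\vdash M:A\mid\Sigma$ is derivable in $\mu\mathsf{DCLL}$, then $\Delta^{\mathsf H};\Gamma^{\mathsf H},(\Sigma^{\mathsf H})^\perp\vdash M^{\mathsf H}:A^{\mathsf H}$ is derivable in $\lambda_{\mathrm{MELL}}$, where $\Delta^{\mathsf H}$ and $\Gamma^{\mathsf H}$ apply $(\cdot)^{\mathsf H}$ to every assigned type and $(\Sigma^{\mathsf H})^\perp$ assigns $(B^{\mathsf H})^\perp$ to $\gamma$ for each $\gamma:B$ in $\Sigma$.
   Context: The calculus $\mu\mathsf{DCLL}$. Types: $A,B::=\bot\mid\alpha\mid A\supset B\mid A\multimap B$ ($\alpha$ atomic). Terms: $M,N::=x\mid u\mid\Lambda u.M\mid M\,@\,N\mid\lambda x.M\mid M\bullet N\mid[\gamma]M\mid\mu\gamma.M$, with $x$ linear variables, $u$ non-linear variables, $\gamma$ (linear) continuation variables. Judgements $\Delta;\Gamma\vdash M:A\mid\Sigma$ ($\Delta$ types non-linear variables, $\Gamma$ linear variables, $\Sigma$ continuation variables; in $\Gamma,\Gamma'$ and $\Sigma,\Sigma'$ domains are disjoint; $\cdot$ is empty). Rules (premises $\Rightarrow$ conclusion): $\Rightarrow\Delta,u:A;\cdot\vdash u:A\mid\cdot$; $\Rightarrow\Delta;x:A\vdash x:A\mid\cdot$; $\Delta,u:A;\Gamma\vdash M:B\mid\Sigma$ $\Rightarrow$ $\Delta;\Gamma\vdash\Lambda u.M:A\supset B\mid\Sigma$; $\Delta;\Gamma\vdash M:A\supset B\mid\Sigma$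 and $\Delta;\cdot\vdash N:A\mid\cdot$ $\Rightarrow$ $\Delta;\Gamma\vdash M\,@\,N:B\mid\Sigma$; $\Delta;\Gamma,x:A\vdash M:B\mid\Sigma$ $\Rightarrow$ $\Delta;\Gamma\vdash\lambda x.M:A\multimap B\mid\Sigma$; $\Delta;\Gamma\vdash M:A\multimap B\mid\Sigma$ and $\Delta;\Gamma'\vdash N:A\mid\Sigma'$ $\Rightarrow$ $\Delta;\Gamma,\Gamma'\vdash M\bullet N:B\mid\Sigma,\Sigma'$; $\Delta;\Gamma\vdash M:A\mid\Sigma$ $\Rightarrow$ $\Delta;\Gamma\vdash[\gamma]M:\bot\mid\Sigma,\gamma:A$; $\Delta;\Gamma\vdash M:\bot\mid\Sigma,\gamma:A$ $\Rightarrow$ $\Delta;\Gamma\vdash\mu\gamma.M:A\mid\Sigma$. MELL formulae: $A,B::=\alpha\mid\overline\alpha\mid A\otimes B\mid A\wp B\mid\mathbf 1\mid\bot\mid{!}A\mid{?}A$ ($\wp$ is "par"). Linear negation is the involution $\alpha^\perp=\overline\alpha$, $\overline\alpha^\perp=\alpha$, $(A\otimes B)^\perp=A^\perp\wp B^\perp$, $(A\wp B)^\perp=A^\perp\otimes B^\perp$, $\mathbf1^\perp=\bot$, $\bot^\perp=\mathbf1$, $({!}A)^\perp={?}(A^\perp)$, $({?}A)^\perp={!}(A^\perp)$. Terms of $\lambda_{\mathrm{MELL}}$, over linear variables $a,b,c,\dots$ and unrestricted variables $u,v,\dots$: $t,s::=a\mid u\mid\langle t,s\rangle\mid t[\langle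 a,b\rangle:=s]\mid\wp(a,b).t\mid t\bullet s\mid t\blacktriangledown s\mid{!}a.t\mid t[{!}u:=s]\mid{?}u.t\mid t\blacktriangleright^{a}s\mid t\,\sharp\,s\mid\star\mid t[\star:=s]$. Binding: $t[\langle a,b\rangle:=s]$ and $\wp(a,b).t$ bind $a,b$ in $t$; ${!}a.t$ and $t\blacktriangleright^a s$ bind $a$ in $t$; $t[{!}u:=s]$ and ${?}u.t$ bind $u$ in $t$. Terms are taken up to $\alpha$-renaming. Typing judgements $\Delta;\Gamma\vdash t:A$, where $\Delta$ (resp. $\Gamma$) is a finite partial function from unrestricted (resp. linear) variables to formulae; $\Gamma,\Gamma'$ denotes union with disjoint domains. Typing rules: $\Rightarrow\Delta;a:A\vdash a:A$; $\Rightarrow\Delta,u:A;\cdot\vdash u:A$; $\Delta;\Gamma\vdash t:A$ and $\Delta;\Gamma'\vdash s:B$ $\Rightarrow$ $\Delta;\Gamma,\Gamma'\vdash\langle t,s\rangle:A\otimes B$; $\Delta;\Gamma\vdash s:A\otimes B$ and $\Delta;\Gamma',a:A,b:B\vdash t:C$ $\Rightarrow$ $\Delta;\Gamma,\Gamma'\vdash t[\langle a,b\rangle:=s]:C$; $\Delta;\Gamma,a:A,b:B\vdash t:\bot$ $\Rightarrow$ $\Delta;\Gamma\vdash\wp(a,b).t:A^\perp\wp B^\perp$; $\Delta;\Gamma\vdash t:A\wp B$ and $\Delta;\Gamma'\vdash s:A^\perp$ $\Rightarrow$ $\Delta;\Gamma,\Gamma'\vdash t\bullet s:B$; $\Delta;\Gamma\vdash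 t:A\wp B$ and $\Delta;\Gamma'\vdash s:B^\perp$ $\Rightarrow$ $\Delta;\Gamma,\Gamma'\vdash t\blacktriangledown s:A$; $\Delta;a:A\vdash t:\bot$ $\Rightarrow$ $\Delta;\cdot\vdash{!}a.t:{!}(A^\perp)$; $\Delta;\Gamma\vdash s:{!}A$ and $\Delta,u:A;\Gamma'\vdash t:B$ $\Rightarrow$ $\Delta;\Gamma,\Gamma'\vdash t[{!}u:=s]:B$; $\Delta,u:A^\perp;\Gamma\vdash t:\bot$ $\Rightarrow$ $\Delta;\Gamma\vdash{?}u.t:{?}A$; $\Delta;\Gamma\vdash s:{?}A$ and $\Delta;a:A\vdash t:\bot$ $\Rightarrow$ $\Delta;\Gamma\vdash t\blacktriangleright^a s:\bot$; $\Delta;\Gamma\vdash t:B$ and $\Delta;\Gamma'\vdash s:B^\perp$ $\Rightarrow$ $\Delta;\Gamma,\Gamma'\vdash t\,\sharp\,s:\bot$; $\Rightarrow\Delta;\cdot\vdash\star:\mathbf1$; $\Delta;\Gamma\vdash s:\mathbf1$ and $\Delta;\Gamma'\vdash t:A$ $\Rightarrow$ $\Delta;\Gamma,\Gamma'\vdash t[\star:=s]:A$. A term is linear if: each free linear variable occurs exactly once; each bound linear variable occurs exactly once in the scope of its binder; subterms ${!}a.t$ have no free linear variables; in subterms $t\blacktriangleright^a s$ only $a$ occurs as a free linear variable in $t$. For a linear term $t$ with $a\in\mathrm{fv}(t)$, the contra-substitution $t\{a\backslash\!\backslash s\}$ is defined by induction on $t$ (case "$i$" applies when $a\in\mathrm{fv}(t_i)$;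 bound variables chosen to avoid capture): $a\{a\backslash\!\backslash s\}=s$; $\langle t_1,t_2\rangle\{a\backslash\!\backslash s\}=t_1\{a\backslash\!\backslash s\blacktriangledown t_2\}$ (case 1), $t_2\{a\backslash\!\backslash s\bullet t_1\}$ (case 2); $(t_1\bullet t_2)\{a\backslash\!\backslash s\}=t_1\{a\backslash\!\backslash\langle t_2,s\rangle\}$ (1), $t_2\{a\backslash\!\backslash t_1\blacktriangledown s\}$ (2); $(t_1\blacktriangledown t_2)\{a\backslash\!\backslash s\}=t_1\{a\backslash\!\backslash\langle s,t_2\rangle\}$ (1), $t_2\{a\backslash\!\backslash t_1\bullet s\}$ (2); $(t_1[\langle b,c\rangle:=t_2])\{a\backslash\!\backslash s\}=(t_1\{a\backslash\!\backslash s\})[\langle b,c\rangle:=t_2]$ (1, $a\notin\{b,c\}$), $t_2\{a\backslash\!\backslash\wp(b,c).(t_1\sharp s)\}$ (2); $(\wp(b,c).t)\{a\backslash\!\backslash s\}=(t\{a\backslash\!\backslash\star\})[\langle b,c\rangle:=s]$; $(t_1[{!}u:=t_2])\{a\backslash\!\backslash s\}=(t_1\{a\backslash\!\backslash s\})[{!}u:=t_2]$ (1), $t_2\{a\backslash\!\backslash{?}u.(t_1\sharp s)\}$ (2); $({?}u.t)\{a\backslash\!\backslash s\}=(t\{a\backslash\!\backslash\star\})[{!}u:=s]$; $(t_1\blacktriangleright^b t_2)\{a\backslash\!\backslash s\}=(t_2\{a\backslash\!\backslash{!}b.t_1\})[\star:=s]$ (only case 2 is possible); $(t_1\sharp t_2)\{a\backslash\!\backslash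 s\}=(t_1\{a\backslash\!\backslash t_2\})[\star:=s]$ (1), $(t_2\{a\backslash\!\backslash t_1\})[\star:=s]$ (2); $(t_1[\star:=t_2])\{a\backslash\!\backslash s\}=(t_1\{a\backslash\!\backslash s\})[\star:=t_2]$ (1), $t_2\{a\backslash\!\backslash t_1\sharp s\}$ (2). Translation $(\cdot)^{\mathsf H}$. Write ${!}t:={!}a.(t\,\sharp\,a)$ with $a$ fresh. Linear and continuation variables of $\mu\mathsf{DCLL}$ are regarded as linear variables, non-linear ones as unrestricted variables. Types: $\bot^{\mathsf H}=\bot$, $\alpha^{\mathsf H}=\alpha$, $(A\supset B)^{\mathsf H}={?}(A^{\mathsf H})^\perp\wp B^{\mathsf H}$, $(A\multimap B)^{\mathsf H}=(A^{\mathsf H})^\perp\wp B^{\mathsf H}$. Terms ($a,k$ fresh linear variables): $x^{\mathsf H}=x$, $u^{\mathsf H}=u$; $(\Lambda u.M)^{\mathsf H}=\wp(a,k).(M^{\mathsf H}[{!}u:=a]\,\sharp\,k)$; $(M\,@\,N)^{\mathsf H}=M^{\mathsf H}\bullet{!}N^{\mathsf H}$; $(\lambda x.M)^{\mathsf H}=\wp(x,k).(M^{\mathsf H}\,\sharp\,k)$; $(M\bullet N)^{\mathsf H}=M^{\mathsf H}\bullet N^{\mathsf H}$; $([\gamma]M)^{\mathsf H}=M^{\mathsf H}\,\sharp\,\gamma$; $(\mu\gamma.M)^{\mathsf H}=M^{\mathsf H}\{\gamma\backslash\!\backslash\star\}$. -}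

module Defs where

open import Data.Fin.Base using (Fin; zero; suc; lift; punchIn; punchOut; splitAt; _↑ˡ_; _↑ʳ_)
open import Data.Fin.Properties using (_≟_)
open import Data.Maybe.Base as Maybe using (Maybe; just; nothing; _>>=_; _<∣>_; zipWith)
open import Data.Nat.Base using (ℕ; zero; suc; _+_)
open import Data.Sum.Base using ([_,_]′)
open import Data.Vec.Base as Vec using (Vec; []; _∷_; lookup; replicate; _[_]≔_)
open import Function.Base using (id; _∘_)
open import Relation.Binary.PropositionalEquality.Core using (_≡_)
open import Relation.Nullary.Decidable.Core using (yes; no)

-- Terms are well-scoped de Bruijn terms, so that α-equivalent terms are equal.
-- A finite partial function with domain contained in a scope of n variables
-- is a vector of optional values.  Such contexts are used for the linear and
-- continuation variables.  For the unrestricted variables the scope is taken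
-- to be the domain, so that a context is a plain vector.

PCtx : Set → ℕ → Set
PCtx X n = Vec (Maybe X) n

private
  variable
    m n m′ n′ l k : ℕ
    X Y : Set

∅ : PCtx X n
∅ = replicate _ nothing

infix 8 _↦_

_↦_ : Fin n → X → PCtx X n
a ↦ x = ∅ [ a ]≔ just x

mapCtx : (X → Y) → PCtx X n → PCtx Y n
mapCtx f = Vec.map (Maybe.map f)

-- Γ ⊎ Γ′ ≋ Θ : the domains of Γ and Γ′ are disjoint and Θ is their union.

infix 4 _⊎_≋_

data _⊎_≋_ {X : Set} : {n : ℕ} → PCtx X n → PCtx X n → PCtx X n → Set where
  []    : [] ⊎ [] ≋ []
  none  : {Γ Γ′ Θ : PCtx X n} → Γ ⊎ Γ′ ≋ Θ →
          nothing ∷ Γ ⊎ nothing ∷ Γ′ ≋ nothing ∷ Θ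
  left  : {Γ Γ′ Θ : PCtx X n} {x : X} → Γ ⊎ Γ′ ≋ Θ →
          just x ∷ Γ ⊎ nothing ∷ Γ′ ≋ just x ∷ Θ
  right : {Γ Γ′ Θ : PCtx X n} {x : X} → Γ ⊎ Γ′ ≋ Θ →
          nothing ∷ Γ ⊎ just x ∷ Γ′ ≋ just x ∷ Θ

Atom : Set
Atom = ℕ

infixr 6 _⊃_ _⊸_

data Type : Set where
  ⊥       : Type
  atom    : Atom → Type
  _⊃_ _⊸_ : Type → Type → Type

-- Term m l k: terms with m non-linear, l linear and k continuation variables
-- in scope.

infixl 7 _＠_ _•_
infix  6 Λ_ ƛ_ μ_ [_]_

data Term (m l k : ℕ) : Set where
  lvar : Fin l → Term m l k
  uvar : Fin m → Term m l k
  Λ_   : Term (suc m) l k → Term m l k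
  _＠_ : Term m l k → Term m l k → Term m l k
  ƛ_   : Term m (suc l) k → Term m l k
  _•_  : Term m l k → Term m l k → Term m l k
  [_]_ : Fin k → Term m l k → Term m l k
  μ_   : Term m l (suc k) → Term m l k

infix 3 _⨾_⊢_∶_∣_

data _⨾_⊢_∶_∣_ {m l k : ℕ} (Δ : Vec Type m) :
     PCtx Type l → Term m l k → Type → PCtx Type k → Set where

  lvar : ∀ {A} (x : Fin l) →
         Δ ⨾ x ↦ A ⊢ lvar x ∶ A ∣ ∅

  uvar : ∀ {A} (u : Fin m) → lookup Δ u ≡ A →
         Δ ⨾ ∅ ⊢ uvar u ∶ A ∣ ∅

  Λ_   : ∀ {Γ M A B Σ} →
         A ∷ Δ ⨾ Γ ⊢ M ∶ B ∣ Σ →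
         Δ ⨾ Γ ⊢ Λ M ∶ A ⊃ B ∣ Σ

  _＠_ : ∀ {Γ M N A B Σ} →
         Δ ⨾ Γ ⊢ M ∶ A ⊃ B ∣ Σ →
         Δ ⨾ ∅ ⊢ N ∶ A ∣ ∅ →
         Δ ⨾ Γ ⊢ M ＠ N ∶ B ∣ Σ

  ƛ_   : ∀ {Γ M A B Σ} →
         Δ ⨾ just A ∷ Γ ⊢ M ∶ B ∣ Σ →
         Δ ⨾ Γ ⊢ ƛ M ∶ A ⊸ B ∣ Σ

  app  : ∀ {Γ Γ′ Θ M N A B Σ Σ′ Ξ} →
         Γ ⊎ Γ′ ≋ Θ → Σ ⊎ Σ′ ≋ Ξ →
         Δ ⨾ Γ ⊢ M ∶ A ⊸ B ∣ Σ →
         Δ ⨾ Γ′ ⊢ N ∶ A ∣ Σ′ →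
         Δ ⨾ Θ ⊢ M • N ∶ B ∣ Ξ

  name : ∀ {Γ M A Σ Ξ} (γ : Fin k) →
         Σ ⊎ γ ↦ A ≋ Ξ →
         Δ ⨾ Γ ⊢ M ∶ A ∣ Σ →
         Δ ⨾ Γ ⊢ [ γ ] M ∶ ⊥ ∣ Ξ

  μ_   : ∀ {Γ M A Σ} →
         Δ ⨾ Γ ⊢ M ∶ ⊥ ∣ just A ∷ Σ →
         Δ ⨾ Γ ⊢ μ M ∶ A ∣ Σ

infixr 6 _⊗_ _⅋_
infix  7 !_ ⁇_
infix  8 _^⊥

data Formula : Set where
  atom atom̅ : Atom → Formula
  _⊗_ _⅋_   : Formula → Formula → Formula
  𝟏 ⊥       : Formula
  !_ ⁇_     : Formula → Formula

_^⊥ : Formula → Formula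
atom α  ^⊥ = atom̅ α
atom̅ α  ^⊥ = atom α
(A ⊗ B) ^⊥ = A ^⊥ ⅋ B ^⊥
(A ⅋ B) ^⊥ = A ^⊥ ⊗ B ^⊥
𝟏       ^⊥ = ⊥
⊥       ^⊥ = 𝟏
(! A)   ^⊥ = ⁇ (A ^⊥)
(⁇ A)   ^⊥ = ! (A ^⊥)

-- Tm m n: terms with m unrestricted and n linear variables in scope.  Where
-- two linear variables a, b are bound, a has index 0 and b has index 1.

data Tm (m n : ℕ) : Set where
  lvar     : Fin n → Tm m n
  uvar     : Fin m → Tm m n
  ⟨_,_⟩    : Tm m n → Tm m n → Tm m n
  _[⟨⟩:=_] : Tm m (2 + n) → Tm m n → Tm m n
  ℘_       : Tm m (2 + n) → Tm m n
  _•_      : Tm m n → Tm m n → Tm m n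
  _▾_      : Tm m n → Tm m n → Tm m n
  ‼_       : Tm m (suc n) → Tm m n
  _[!:=_]  : Tm (suc m) n → Tm m n → Tm m n
  ⁇_       : Tm (suc m) n → Tm m n
  _▸_      : Tm m (suc n) → Tm m n → Tm m n
  _♯_      : Tm m n → Tm m n → Tm m n
  ⋆        : Tm m n
  _[⋆:=_]  : Tm m n → Tm m n → Tm m n

infix  9 _[⟨⟩:=_] _[!:=_] _[⋆:=_]
infixl 7 _▾_
infix  6 _▸_ _♯_
infix  5 ℘_ ‼_

infix 3 _⨾_⊢_∶_

data _⨾_⊢_∶_ {m n : ℕ} (Δ : Vec Formula m) :
     PCtx Formula n → Tm m n → Formula → Set where

  lvar  : ∀ {A} (a : Fin n) →
          Δ ⨾ a ↦ A ⊢ lvar a ∶ A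

  uvar  : ∀ {A} (u : Fin m) → lookup Δ u ≡ A →
          Δ ⨾ ∅ ⊢ uvar u ∶ A

  ⊗-intro : ∀ {Γ Γ′ Θ t s A B} → Γ ⊎ Γ′ ≋ Θ →
          Δ ⨾ Γ ⊢ t ∶ A →
          Δ ⨾ Γ′ ⊢ s ∶ B →
          Δ ⨾ Θ ⊢ ⟨ t , s ⟩ ∶ A ⊗ B

  ⊗-elim : ∀ {Γ Γ′ Θ t s A B C} → Γ ⊎ Γ′ ≋ Θ →
          Δ ⨾ Γ ⊢ s ∶ A ⊗ B →
          Δ ⨾ just A ∷ just B ∷ Γ′ ⊢ t ∶ C →
          Δ ⨾ Θ ⊢ t [⟨⟩:= s ] ∶ C

  ⅋-intro : ∀ {Γ t A B} →
          Δ ⨾ just A ∷ just B ∷ Γ ⊢ t ∶ ⊥ →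
          Δ ⨾ Γ ⊢ ℘ t ∶ A ^⊥ ⅋ B ^⊥

  ⅋-elim₁ : ∀ {Γ Γ′ Θ t s A B} → Γ ⊎ Γ′ ≋ Θ →
          Δ ⨾ Γ ⊢ t ∶ A ⅋ B →
          Δ ⨾ Γ′ ⊢ s ∶ A ^⊥ →
          Δ ⨾ Θ ⊢ t • s ∶ B

  ⅋-elim₂ : ∀ {Γ Γ′ Θ t s A B} → Γ ⊎ Γ′ ≋ Θ →
          Δ ⨾ Γ ⊢ t ∶ A ⅋ B →
          Δ ⨾ Γ′ ⊢ s ∶ B ^⊥ →
          Δ ⨾ Θ ⊢ t ▾ s ∶ A

  !-intro : ∀ {t A} →
          Δ ⨾ just A ∷ ∅ ⊢ t ∶ ⊥ →
          Δ ⨾ ∅ ⊢ ‼ t ∶ ! (A ^⊥)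

  !-elim : ∀ {Γ Γ′ Θ t s A B} → Γ ⊎ Γ′ ≋ Θ →
          Δ ⨾ Γ ⊢ s ∶ ! A →
          A ∷ Δ ⨾ Γ′ ⊢ t ∶ B →
          Δ ⨾ Θ ⊢ t [!:= s ] ∶ B

  ?-intro : ∀ {Γ t A} →
          A ^⊥ ∷ Δ ⨾ Γ ⊢ t ∶ ⊥ →
          Δ ⨾ Γ ⊢ ⁇ t ∶ ⁇ A

  ?-elim : ∀ {Γ t s A} →
          Δ ⨾ Γ ⊢ s ∶ ⁇ A →
          Δ ⨾ just A ∷ ∅ ⊢ t ∶ ⊥ →
          Δ ⨾ Γ ⊢ t ▸ s ∶ ⊥

  cut   : ∀ {Γ Γ′ Θ t s B} → Γ ⊎ Γ′ ≋ Θ →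
          Δ ⨾ Γ ⊢ t ∶ B →
          Δ ⨾ Γ′ ⊢ s ∶ B ^⊥ →
          Δ ⨾ Θ ⊢ t ♯ s ∶ ⊥

  𝟏-intro : Δ ⨾ ∅ ⊢ ⋆ ∶ 𝟏

  𝟏-elim : ∀ {Γ Γ′ Θ t s A} → Γ ⊎ Γ′ ≋ Θ →
          Δ ⨾ Γ ⊢ s ∶ 𝟏 →
          Δ ⨾ Γ′ ⊢ t ∶ A →
          Δ ⨾ Θ ⊢ t [⋆:= s ] ∶ A

rename : (Fin m → Fin m′) → (Fin n → Fin n′) → Tm m n → Tm m′ n′
rename ρ σ (lvar a)        = lvar (σ a)
rename ρ σ (uvar u)        = uvar (ρ u)
rename ρ σ ⟨ t , s ⟩       = ⟨ rename ρ σ t , rename ρ σ s ⟩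
rename ρ σ (t [⟨⟩:= s ])   = rename ρ (lift 2 σ) t [⟨⟩:= rename ρ σ s ]
rename ρ σ (℘ t)           = ℘ rename ρ (lift 2 σ) t
rename ρ σ (t • s)         = rename ρ σ t • rename ρ σ s
rename ρ σ (t ▾ s)         = rename ρ σ t ▾ rename ρ σ s
rename ρ σ (‼ t)           = ‼ rename ρ (lift 1 σ) t
rename ρ σ (t [!:= s ])    = rename (lift 1 ρ) σ t [!:= rename ρ σ s ]
rename ρ σ (⁇ t)           = ⁇ rename (lift 1 ρ) σ t
rename ρ σ (t ▸ s)         = rename ρ (lift 1 σ) t ▸ rename ρ σ s
rename ρ σ (t ♯ s)         = rename ρ σ t ♯ rename ρ σ s
rename ρ σ ⋆               = ⋆
rename ρ σ (t [⋆:= s ])    = rename ρ σ t [⋆:= rename ρ σ s ]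

weakenL : ∀ j → Tm m n → Tm m (j + n)
weakenL j = rename id (j ↑ʳ_)

weakenU : Tm m n → Tm (suc m) n
weakenU = rename suc id

-- strengthen a t is t with the linear variable a removed from its scope; it
-- is defined exactly when a ∉ fv(t).

strengthenVar : Fin (suc n) → Fin (suc n) → Maybe (Fin n)
strengthenVar a b with a ≟ b
... | yes _  = nothing
... | no a≢b = just (punchOut a≢b)

strengthen : Fin (suc n) → Tm m (suc n) → Maybe (Tm m n)
strengthen a (lvar b)      = Maybe.map lvar (strengthenVar a b)
strengthen a (uvar u)      = just (uvar u)
strengthen a ⟨ t , s ⟩     = zipWith ⟨_,_⟩ (strengthen a t) (strengthen a s)
strengthen a (t [⟨⟩:= s ]) = zipWith _[⟨⟩:=_] (strengthen (suc (suc a)) t) (strengthen a s)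
strengthen a (℘ t)         = Maybe.map ℘_ (strengthen (suc (suc a)) t)
strengthen a (t • s)       = zipWith _•_ (strengthen a t) (strengthen a s)
strengthen a (t ▾ s)       = zipWith _▾_ (strengthen a t) (strengthen a s)
strengthen a (‼ t)         = Maybe.map ‼_ (strengthen (suc a) t)
strengthen a (t [!:= s ])  = zipWith _[!:=_] (strengthen a t) (strengthen a s)
strengthen a (⁇ t)         = Maybe.map ⁇_ (strengthen a t)
strengthen a (t ▸ s)       = zipWith _▸_ (strengthen (suc a) t) (strengthen a s)
strengthen a (t ♯ s)       = zipWith _♯_ (strengthen a t) (strengthen a s)
strengthen a ⋆             = just ⋆
strengthen a (t [⋆:= s ])  = zipWith _[⋆:=_] (strengthen a t) (strengthen a s)

-- t ⟪ a ⑊ s ⟫ is a partial function: it is defined when a occurs exactly once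
-- in t, outside every subterm ‼ r and outside r in every subterm r ▸ r′, which
-- is the case for linear t with a ∈ fv(t).  The variable a is removed from the
-- scope, so the side not containing a has to be strengthened.  In a clause
-- with two alternatives, the first applies when a occurs in t₁ (and so not in
-- t₂), the second when a occurs in t₂.

infix 10 _⟪_⑊_⟫

_⟪_⑊_⟫ : Tm m (suc n) → Fin (suc n) → Tm m n → Maybe (Tm m n)
lvar b ⟪ a ⑊ s ⟫ with a ≟ b
... | yes _ = just s
... | no  _ = nothing
uvar u ⟪ a ⑊ s ⟫ = nothing
⟨ t₁ , t₂ ⟩ ⟪ a ⑊ s ⟫ =
      (do t₂′ ← strengthen a t₂
          t₁ ⟪ a ⑊ s ▾ t₂′ ⟫)
  <∣> (do t₁′ ← strengthen a t₁
          t₂ ⟪ a ⑊ s • t₁′ ⟫)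
(t₁ • t₂) ⟪ a ⑊ s ⟫ =
      (do t₂′ ← strengthen a t₂
          t₁ ⟪ a ⑊ ⟨ t₂′ , s ⟩ ⟫)
  <∣> (do t₁′ ← strengthen a t₁
          t₂ ⟪ a ⑊ t₁′ ▾ s ⟫)
(t₁ ▾ t₂) ⟪ a ⑊ s ⟫ =
      (do t₂′ ← strengthen a t₂
          t₁ ⟪ a ⑊ ⟨ s , t₂′ ⟩ ⟫)
  <∣> (do t₁′ ← strengthen a t₁
          t₂ ⟪ a ⑊ t₁′ • s ⟫)
(t₁ [⟨⟩:= t₂ ]) ⟪ a ⑊ s ⟫ =
      (do t₂′ ← strengthen a t₂
          r   ← t₁ ⟪ suc (suc a) ⑊ weakenL 2 s ⟫
          just (r [⟨⟩:= t₂′ ]))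
  <∣> (do t₁′ ← strengthen (suc (suc a)) t₁
          t₂ ⟪ a ⑊ ℘ (t₁′ ♯ weakenL 2 s) ⟫)
(℘ t) ⟪ a ⑊ s ⟫ = do
  r ← t ⟪ suc (suc a) ⑊ ⋆ ⟫
  just (r [⟨⟩:= s ])
(‼ t) ⟪ a ⑊ s ⟫ = nothing
(t₁ [!:= t₂ ]) ⟪ a ⑊ s ⟫ =
      (do t₂′ ← strengthen a t₂
          r   ← t₁ ⟪ a ⑊ weakenU s ⟫
          just (r [!:= t₂′ ]))
  <∣> (do t₁′ ← strengthen a t₁
          t₂ ⟪ a ⑊ ⁇ (t₁′ ♯ weakenU s) ⟫)
(⁇ t) ⟪ a ⑊ s ⟫ = do
  r ← t ⟪ a ⑊ ⋆ ⟫
  just (r [!:= s ])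
(t₁ ▸ t₂) ⟪ a ⑊ s ⟫ = do
  t₁′ ← strengthen (suc a) t₁
  r   ← t₂ ⟪ a ⑊ ‼ t₁′ ⟫
  just (r [⋆:= s ])
(t₁ ♯ t₂) ⟪ a ⑊ s ⟫ =
      (do t₂′ ← strengthen a t₂
          r   ← t₁ ⟪ a ⑊ t₂′ ⟫
          just (r [⋆:= s ]))
  <∣> (do t₁′ ← strengthen a t₁
          r   ← t₂ ⟪ a ⑊ t₁′ ⟫
          just (r [⋆:= s ]))
⋆ ⟪ a ⑊ s ⟫ = nothing
(t₁ [⋆:= t₂ ]) ⟪ a ⑊ s ⟫ =
      (do t₂′ ← strengthen a t₂
          r   ← t₁ ⟪ a ⑊ s ⟫
          just (r [⋆:= t₂′ ]))
  <∣> (do t₁′ ← strengthen a t₁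
          t₂ ⟪ a ⑊ t₁′ ♯ s ⟫)

infix 8 _ᴴ _ᴴᵗ

_ᴴ : Type → Formula
⊥       ᴴ = ⊥
atom α  ᴴ = atom α
(A ⊃ B) ᴴ = ⁇ (A ᴴ ^⊥) ⅋ B ᴴ
(A ⊸ B) ᴴ = A ᴴ ^⊥ ⅋ B ᴴ

!ᵗ_ : Tm m n → Tm m n
!ᵗ t = ‼ (weakenL 1 t ♯ lvar zero)

-- With l linear and k continuation variables in scope, the linear variables
-- of the translation are indexed by Fin (l + k): x becomes x ↑ˡ k and γ
-- becomes l ↑ʳ γ.  The following renaming moves the most recently bound
-- continuation variable to the front.

focus : ∀ l → Fin (l + suc k) → Fin (suc (l + k))
focus {k} l = [ (λ x → suc (x ↑ˡ k)) , lift 1 (l ↑ʳ_) ]′ ∘ splitAt l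

-- Partial, because contra-substitution is.

_ᴴᵗ : Term m l k → Maybe (Tm m (l + k))
_ᴴᵗ {k = k} (lvar x) = just (lvar (x ↑ˡ k))
uvar u ᴴᵗ            = just (uvar u)
(Λ M) ᴴᵗ             = do
  t ← M ᴴᵗ
  just (℘ (weakenL 2 t [!:= lvar zero ] ♯ lvar (suc zero)))
(M ＠ N) ᴴᵗ          = do
  t ← M ᴴᵗ
  s ← N ᴴᵗ
  just (t • (!ᵗ s))
(ƛ M) ᴴᵗ             = do
  t ← M ᴴᵗ
  just (℘ (rename id (punchIn (suc zero)) t ♯ lvar (suc zero)))
(M • N) ᴴᵗ           = do
  t ← M ᴴᵗ
  s ← N ᴴᵗ
  just (t • s)
_ᴴᵗ {l = l} ([ γ ] M) = do
  t ← M ᴴᵗ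
  just (t ♯ lvar (l ↑ʳ γ))
_ᴴᵗ {l = l} (μ M)    = do
  t ← M ᴴᵗ
  rename id (focus l) t ⟪ zero ⑊ ⋆ ⟫

{-# OPTIONS --safe #-}
module Submission where

-- The heart of the proof is the typing rule for contra-substitution: from
-- Γ, a : A ⊢ t : B and Γ′ ⊢ s : B ^⊥ follows Γ, Γ′ ⊢ t {a \\ s} : A ^⊥, by
-- induction on t; linearity decides which subterm contains a, and the other
-- subterm is absorbed into s.  The case of μ γ. M is the instance B = ⊥, s = ⋆.

open import Defs
open import Data.Empty using (⊥-elim)
open import Data.Fin.Base using (Fin; zero; suc; lift; punchIn; punchOut; splitAt; _↑ˡ_; _↑ʳ_)
open import Data.Fin.Properties using (_≟_; splitAt⁻¹-↑ˡ; splitAt⁻¹-↑ʳ; splitAt-↑ˡ; splitAt-↑ʳ)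
open import Data.Maybe.Base as Maybe using (Maybe; just; nothing; _>>=_; _<∣>_; zipWith)
open import Data.Maybe.Relation.Unary.Any using (Any; just)
open import Data.Nat.Base using (ℕ; zero; suc; _+_)
open import Data.Product.Base using (_×_; _,_; ∃-syntax)
open import Data.Sum.Base using ([_,_]′; inj₁; inj₂)
open import Data.Vec.Base using (Vec; []; _∷_; map; _++_; lookup; tabulate; _[_]≔_)
open import Data.Vec.Properties
  using (map-[]≔; map-replicate; lookup-map; lookup-replicate; lookup∘update; lookup∘update′;
         lookup-++ˡ; lookup-++ʳ; lookup-splitAt; tabulate-cong; tabulate∘lookup)
open import Function.Base using (id; _∘_)
open import Relation.Binary.PropositionalEquality
  using (_≡_; _≢_; _≗_; refl; sym; trans; cong; cong₂; subst)
open import Relation.Nullary.Decidable.Core using (yes; no)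

private
  variable
    m m′ n n′ l k : ℕ
    X Y : Set
    x y : Maybe X
    Γ Γ₁ Γ₂ Γ₃ Γ₁₂ Θ Ξ : PCtx X n
    Δ : Vec Formula m

-- Linear negation and transport of typings.

^⊥-involutive : ∀ A → A ^⊥ ^⊥ ≡ A
^⊥-involutive (atom α)  = refl
^⊥-involutive (atom̅ α)  = refl
^⊥-involutive (A ⊗ B)   = cong₂ _⊗_ (^⊥-involutive A) (^⊥-involutive B)
^⊥-involutive (A ⅋ B)   = cong₂ _⅋_ (^⊥-involutive A) (^⊥-involutive B)
^⊥-involutive 𝟏         = refl
^⊥-involutive ⊥         = refl
^⊥-involutive (! A)     = cong !_ (^⊥-involutive A)
^⊥-involutive (⁇ A)     = cong ⁇_ (^⊥-involutive A)

cast : ∀ {t : Tm m n} {A B} → A ≡ B → Δ ⨾ Γ ⊢ t ∶ A → Δ ⨾ Γ ⊢ t ∶ B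
cast {Δ = Δ} {Γ = Γ} {t = t} = subst (Δ ⨾ Γ ⊢ t ∶_)

-- Negation computes only on constructors, so for a variable formula `A ^⊥ ^⊥` and `A` are not
-- definitionally equal and typings have to be transported.
^⊥^⊥-intro : ∀ {t : Tm m n} {A} → Δ ⨾ Γ ⊢ t ∶ A → Δ ⨾ Γ ⊢ t ∶ A ^⊥ ^⊥
^⊥^⊥-intro {A = A} = cast (sym (^⊥-involutive A))

hyp-^⊥^⊥-intro : ∀ {t : Tm (suc m) n} {A B} → A ∷ Δ ⨾ Γ ⊢ t ∶ B → A ^⊥ ^⊥ ∷ Δ ⨾ Γ ⊢ t ∶ B
hyp-^⊥^⊥-intro {Δ = Δ} {Γ = Γ} {t = t} {A} {B} =
  subst (λ F → F ∷ Δ ⨾ Γ ⊢ t ∶ B) (sym (^⊥-involutive A))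

castCtx : ∀ {t : Tm m n} {A} → Γ₁ ≡ Γ₂ → Δ ⨾ Γ₁ ⊢ t ∶ A → Δ ⨾ Γ₂ ⊢ t ∶ A
castCtx refl d = d

-- Disjoint unions of contexts.

⊎-comm : Γ₁ ⊎ Γ₂ ≋ Θ → Γ₂ ⊎ Γ₁ ≋ Θ
⊎-comm []        = []
⊎-comm (none p)  = none (⊎-comm p)
⊎-comm (left p)  = right (⊎-comm p)
⊎-comm (right p) = left (⊎-comm p)

⊎-identityʳ : (Γ : PCtx X n) → Γ ⊎ ∅ ≋ Γ
⊎-identityʳ []            = []
⊎-identityʳ (nothing ∷ Γ) = none (⊎-identityʳ Γ)
⊎-identityʳ (just _ ∷ Γ)  = left (⊎-identityʳ Γ)

-- This is the resource bookkeeping of contra-substitution: the variables of `s` are regrouped with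
-- those of one of the two subterms.
⊎-assoc : Γ₁ ⊎ Γ₂ ≋ Γ₁₂ → Γ₁₂ ⊎ Γ₃ ≋ Θ →
          ∃[ Γ₂₃ ] (Γ₂ ⊎ Γ₃ ≋ Γ₂₃) × (Γ₁ ⊎ Γ₂₃ ≋ Θ)
⊎-assoc []        []        = _ , [] , []
⊎-assoc (none p)  (none q)  = let _ , r , s = ⊎-assoc p q in _ , none r , none s
⊎-assoc (none p)  (right q) = let _ , r , s = ⊎-assoc p q in _ , right r , right s
⊎-assoc (left p)  (left q)  = let _ , r , s = ⊎-assoc p q in _ , none r , left s
⊎-assoc (right p) (left q)  = let _ , r , s = ⊎-assoc p q in _ , left r , right s

⊎-++ : ∀ {Γ Γ′ Θ : PCtx X l} {Σ Σ′ Ξ : PCtx X k} →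
       Γ ⊎ Γ′ ≋ Θ → Σ ⊎ Σ′ ≋ Ξ → Γ ++ Σ ⊎ Γ′ ++ Σ′ ≋ Θ ++ Ξ
⊎-++ []        q = q
⊎-++ (none p)  q = none (⊎-++ p q)
⊎-++ (left p)  q = left (⊎-++ p q)
⊎-++ (right p) q = right (⊎-++ p q)

⊎-identityˡ⁻¹ : ∅ ⊎ Γ ≋ Θ → Γ ≡ Θ
⊎-identityˡ⁻¹ []        = refl
⊎-identityˡ⁻¹ (none p)  = cong (nothing ∷_) (⊎-identityˡ⁻¹ p)
⊎-identityˡ⁻¹ (right p) = cong (just _ ∷_) (⊎-identityˡ⁻¹ p)

⊎-map : (f : X → Y) → Γ₁ ⊎ Γ₂ ≋ Θ → mapCtx f Γ₁ ⊎ mapCtx f Γ₂ ≋ mapCtx f Θ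
⊎-map f []        = []
⊎-map f (none p)  = none (⊎-map f p)
⊎-map f (left p)  = left (⊎-map f p)
⊎-map f (right p) = right (⊎-map f p)

map-∅ : (f : X → Y) → mapCtx f (∅ {n = n}) ≡ ∅
map-∅ f = map-replicate (Maybe.map f) nothing _

map-↦ : (f : X → Y) (a : Fin n) {A : X} → mapCtx f (a ↦ A) ≡ a ↦ f A
map-↦ f a = trans (map-[]≔ (Maybe.map f) ∅ a) (cong (_[ a ]≔ _) (map-∅ f))

∅-++ : ∀ l → ∅ {X} {l} ++ ∅ {X} {k} ≡ ∅
∅-++ zero    = refl
∅-++ (suc l) = cong (nothing ∷_) (∅-++ l)

↦-++-∅ : (a : Fin l) {A : X} → (a ↦ A) ++ ∅ ≡ (a ↑ˡ k) ↦ A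
↦-++-∅ {l = suc l} zero    = cong (just _ ∷_) (∅-++ l)
↦-++-∅ {l = suc l} (suc a) = cong (nothing ∷_) (↦-++-∅ a)

∅-++-↦ : ∀ l (b : Fin k) {A : X} → ∅ {n = l} ++ (b ↦ A) ≡ (l ↑ʳ b) ↦ A
∅-++-↦ zero    b = refl
∅-++-↦ (suc l) b = cong (nothing ∷_) (∅-++-↦ l b)

-- Contexts with one distinguished variable.

-- A relation rather than a function, so that the entry and the remaining context are recovered from
-- a given `Θ` by matching. For typing contexts the entry is itself optional: `nothing` says that
-- the term lacks `a`, `just A` that it owns `a`.
data Insert {X : Set} : {n : ℕ} → Fin (suc n) → X → Vec X n → Vec X (suc n) → Set where
  here  : {x : X} {Γ : Vec X n} → Insert zero x Γ (x ∷ Γ)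
  there : {a : Fin (suc n)} {x y : X} {Γ : Vec X n} {Θ : Vec X (suc n)} →
          Insert a x Γ Θ → Insert (suc a) x (y ∷ Γ) (y ∷ Θ)

insert-∅ : (a : Fin (suc n)) → Insert a nothing (∅ {X}) ∅
insert-∅ zero                = here
insert-∅ {n = suc _} (suc a) = there (insert-∅ a)

insert-∅⁻¹ : {a : Fin (suc n)} → Insert a x Γ ∅ → x ≡ nothing × Γ ≡ ∅
insert-∅⁻¹ here      = refl , refl
insert-∅⁻¹ (there i) with refl , refl ← insert-∅⁻¹ i = refl , refl

insert-↦⁻¹ : ∀ (a : Fin (suc n)) {A : X} → Insert a x Γ (a ↦ A) → x ≡ just A × Γ ≡ ∅
insert-↦⁻¹ zero    here      = refl , refl
insert-↦⁻¹ (suc a) (there i) with refl , refl ← insert-↦⁻¹ a i = refl , refl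

-- The disequality is an argument so that `punchOut a≢b` is literally the variable returned by
-- `strengthenVar`.
insert-↦-≢⁻¹ : ∀ (a b : Fin (suc n)) (a≢b : a ≢ b) {A : X} →
               Insert a x Γ (b ↦ A) → x ≡ nothing × Γ ≡ punchOut a≢b ↦ A
insert-↦-≢⁻¹ zero    zero    a≢b i         = ⊥-elim (a≢b refl)
insert-↦-≢⁻¹ zero    (suc b) a≢b here      = refl , refl
insert-↦-≢⁻¹ (suc a) zero    a≢b (there i) with refl , refl ← insert-∅⁻¹ i = refl , refl
insert-↦-≢⁻¹ (suc a) (suc b) a≢b (there i)
  with refl , refl ← insert-↦-≢⁻¹ a b (a≢b ∘ cong suc) i = refl , refl

-- In the conclusion the entries at a are moved to the front, so that one case
-- distinction on the resulting union decides which side owns a.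

insert-⊎⁻¹ : {a : Fin (suc n)} → Insert a x Γ Θ → Γ₁ ⊎ Γ₂ ≋ Θ →
             ∃[ x₁ ] ∃[ x₂ ] ∃[ Γ₁′ ] ∃[ Γ₂′ ]
             Insert a x₁ Γ₁′ Γ₁ × Insert a x₂ Γ₂′ Γ₂ × (x₁ ∷ Γ₁′ ⊎ x₂ ∷ Γ₂′ ≋ x ∷ Γ)
insert-⊎⁻¹ here (none p)  = _ , _ , _ , _ , here , here , none p
insert-⊎⁻¹ here (left p)  = _ , _ , _ , _ , here , here , left p
insert-⊎⁻¹ here (right p) = _ , _ , _ , _ , here , here , right p
insert-⊎⁻¹ (there i) (none p) with insert-⊎⁻¹ i p
... | _ , _ , _ , _ , i₁ , i₂ , none q  = _ , _ , _ , _ , there i₁ , there i₂ , none (none q)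
... | _ , _ , _ , _ , i₁ , i₂ , left q  = _ , _ , _ , _ , there i₁ , there i₂ , left (none q)
... | _ , _ , _ , _ , i₁ , i₂ , right q = _ , _ , _ , _ , there i₁ , there i₂ , right (none q)
insert-⊎⁻¹ (there i) (left p) with insert-⊎⁻¹ i p
... | _ , _ , _ , _ , i₁ , i₂ , none q  = _ , _ , _ , _ , there i₁ , there i₂ , none (left q)
... | _ , _ , _ , _ , i₁ , i₂ , left q  = _ , _ , _ , _ , there i₁ , there i₂ , left (left q)
... | _ , _ , _ , _ , i₁ , i₂ , right q = _ , _ , _ , _ , there i₁ , there i₂ , right (left q)
insert-⊎⁻¹ (there i) (right p) with insert-⊎⁻¹ i p
... | _ , _ , _ , _ , i₁ , i₂ , none q  = _ , _ , _ , _ , there i₁ , there i₂ , none (right q)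
... | _ , _ , _ , _ , i₁ , i₂ , left q  = _ , _ , _ , _ , there i₁ , there i₂ , left (right q)
... | _ , _ , _ , _ , i₁ , i₂ , right q = _ , _ , _ , _ , there i₁ , there i₂ , right (right q)

-- Renaming and weakening.

-- Contexts are renamed along a partial map τ going backwards, because pulling
-- back preserves disjoint unions for every τ.

pull : (Fin n′ → Maybe (Fin n)) → PCtx X n → PCtx X n′
pull τ Γ = tabulate (λ j → τ j >>= lookup Γ)

-- An entry is treated as a context of length one, so that `⊎-++` can reassemble the pointwise
-- unions in `tabulate-⊎`.
lookup-⊎ : Γ₁ ⊎ Γ₂ ≋ Θ → (i : Fin n) →
           (lookup Γ₁ i ∷ []) ⊎ (lookup Γ₂ i ∷ []) ≋ (lookup Θ i ∷ [])
lookup-⊎ (none p)  zero    = none []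
lookup-⊎ (left p)  zero    = left []
lookup-⊎ (right p) zero    = right []
lookup-⊎ (none p)  (suc i) = lookup-⊎ p i
lookup-⊎ (left p)  (suc i) = lookup-⊎ p i
lookup-⊎ (right p) (suc i) = lookup-⊎ p i

tabulate-⊎ : {f g h : Fin n → Maybe X} → (∀ j → (f j ∷ []) ⊎ (g j ∷ []) ≋ (h j ∷ [])) →
             tabulate f ⊎ tabulate g ≋ tabulate h
tabulate-⊎ {n = zero}  p = []
tabulate-⊎ {n = suc n} p = ⊎-++ (p zero) (tabulate-⊎ (p ∘ suc))

pull-⊎ : (τ : Fin n′ → Maybe (Fin n)) → Γ₁ ⊎ Γ₂ ≋ Θ → pull τ Γ₁ ⊎ pull τ Γ₂ ≋ pull τ Θ
pull-⊎ {Γ₁ = Γ₁} {Γ₂ = Γ₂} {Θ = Θ} τ p = tabulate-⊎ pointwise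
  where
  pointwise : ∀ j → ((τ j >>= lookup Γ₁) ∷ []) ⊎ ((τ j >>= lookup Γ₂) ∷ []) ≋ ((τ j >>= lookup Θ) ∷ [])
  pointwise j with τ j
  ... | nothing = none []
  ... | just i  = lookup-⊎ p i

pull-∅ : (τ : Fin n′ → Maybe (Fin n)) → pull {X = X} τ ∅ ≡ ∅
pull-∅ τ = trans (tabulate-cong pointwise) (tabulate∘lookup ∅)
  where
  pointwise : ∀ j → (τ j >>= lookup ∅) ≡ lookup ∅ j
  pointwise j with τ j
  ... | nothing = sym (lookup-replicate j nothing)
  ... | just i  = trans (lookup-replicate i nothing) (sym (lookup-replicate j nothing))

-- `on-image` makes `σ` injective, and `off-image` forces `τ` to be `nothing` outside the image: `τ`
-- is the inverse of `σ` as a partial map.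
record _⁻¹≗_ (σ : Fin n → Fin n′) (τ : Fin n′ → Maybe (Fin n)) : Set where
  field
    on-image  : ∀ i → τ (σ i) ≡ just i
    off-image : ∀ {i j} → τ j ≡ just i → σ i ≡ j

open _⁻¹≗_

-- Unlike `∅` and unions, a singleton depends on `τ` inverting `σ`: `on-image` puts the entry at
-- `σ a`, and `off-image` keeps every other index from reaching `a`.
pull-↦ : {σ : Fin n → Fin n′} {τ : Fin n′ → Maybe (Fin n)} → σ ⁻¹≗ τ →
         (a : Fin n) {A : X} → pull τ (a ↦ A) ≡ σ a ↦ A
pull-↦ {σ = σ} {τ = τ} inv a {A} = trans (tabulate-cong pointwise) (tabulate∘lookup (σ a ↦ A))
  where
  pointwise : ∀ j → (τ j >>= lookup (a ↦ A)) ≡ lookup (σ a ↦ A) j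
  pointwise j with σ a ≟ j
  ... | yes refl rewrite on-image inv a =
    trans (lookup∘update a ∅ (just A)) (sym (lookup∘update (σ a) ∅ (just A)))
  ... | no σa≢j = trans outside (sym (trans (lookup∘update′ (σa≢j ∘ sym) ∅ (just A)) (lookup-replicate j nothing)))
    where
    outside : (τ j >>= lookup (a ↦ A)) ≡ nothing
    outside with τ j in eq
    ... | nothing = refl
    ... | just i  = trans
      (lookup∘update′ {i = i} {j = a} (λ i≡a → σa≢j (off-image inv (trans eq (cong just i≡a)))) ∅ (just A))
      (lookup-replicate i nothing)

liftᵖ : (Fin n′ → Maybe (Fin n)) → Fin (suc n′) → Maybe (Fin (suc n))
liftᵖ τ zero    = just zero
liftᵖ τ (suc j) = Maybe.map suc (τ j)

pull-liftᵖ : (τ : Fin n′ → Maybe (Fin n)) (Γ : PCtx X n) → pull (liftᵖ τ) (x ∷ Γ) ≡ x ∷ pull τ Γ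
pull-liftᵖ {x = x} τ Γ = cong (x ∷_) (tabulate-cong pointwise)
  where
  pointwise : ∀ j → (Maybe.map suc (τ j) >>= lookup (x ∷ Γ)) ≡ (τ j >>= lookup Γ)
  pointwise j with τ j
  ... | nothing = refl
  ... | just _  = refl

pull-lift₂ᵖ : (τ : Fin n′ → Maybe (Fin n)) (Γ : PCtx X n) →
              pull (liftᵖ (liftᵖ τ)) (x ∷ y ∷ Γ) ≡ x ∷ y ∷ pull τ Γ
pull-lift₂ᵖ {x = x} {y = y} τ Γ = trans (pull-liftᵖ (liftᵖ τ) (y ∷ Γ)) (cong (x ∷_) (pull-liftᵖ τ Γ))

lift-⁻¹≗ : {σ : Fin n → Fin n′} {τ : Fin n′ → Maybe (Fin n)} → σ ⁻¹≗ τ → lift 1 σ ⁻¹≗ liftᵖ τ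
lift-⁻¹≗ inv .on-image zero    = refl
lift-⁻¹≗ inv .on-image (suc i) = cong (Maybe.map suc) (on-image inv i)
lift-⁻¹≗ inv .off-image {j = zero} refl = refl
lift-⁻¹≗ {τ = τ} inv .off-image {j = suc j} eq with τ j in eq′
lift-⁻¹≗ inv .off-image {j = suc j} refl | just i = cong suc (off-image inv eq′)

lift-lookup : {ρ : Fin m → Fin m′} {Δ : Vec X m} {Δ′ : Vec X m′} {A : X} →
              (∀ u → lookup Δ′ (ρ u) ≡ lookup Δ u) →
              ∀ u → lookup (A ∷ Δ′) (lift 1 ρ u) ≡ lookup (A ∷ Δ) u
lift-lookup eq zero    = refl
lift-lookup eq (suc u) = eq u

-- Bridges maps that agree only pointwise, such as `lift 1 (lift 1 σ)` and `lift 2 σ`, or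
-- `lift 1 suc` and `punchIn (suc zero)`.
⁻¹≗-resp-≗ : {σ σ′ : Fin n → Fin n′} {τ : Fin n′ → Maybe (Fin n)} → σ ≗ σ′ → σ ⁻¹≗ τ → σ′ ⁻¹≗ τ
⁻¹≗-resp-≗ {τ = τ} eq inv .on-image i = trans (cong τ (sym (eq i))) (on-image inv i)
⁻¹≗-resp-≗ eq inv .off-image e        = trans (sym (eq _)) (off-image inv e)

lift₂-⁻¹≗ : {σ : Fin n → Fin n′} {τ : Fin n′ → Maybe (Fin n)} → σ ⁻¹≗ τ → lift 2 σ ⁻¹≗ liftᵖ (liftᵖ τ)
lift₂-⁻¹≗ {σ = σ} inv = ⁻¹≗-resp-≗ pointwise (lift-⁻¹≗ (lift-⁻¹≗ inv))
  where
  pointwise : lift 1 (lift 1 σ) ≗ lift 2 σ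
  pointwise zero          = refl
  pointwise (suc zero)    = refl
  pointwise (suc (suc i)) = refl

id-⁻¹≗ : id ⁻¹≗ just {A = Fin n}
id-⁻¹≗ .on-image i     = refl
id-⁻¹≗ .off-image refl = refl

skipᵖ : (Fin n′ → Maybe (Fin n)) → Fin (suc n′) → Maybe (Fin n)
skipᵖ τ zero    = nothing
skipᵖ τ (suc j) = τ j

suc-⁻¹≗ : {σ : Fin n → Fin n′} {τ : Fin n′ → Maybe (Fin n)} → σ ⁻¹≗ τ → (suc ∘ σ) ⁻¹≗ skipᵖ τ
suc-⁻¹≗ inv .on-image i              = on-image inv i
suc-⁻¹≗ inv .off-image {j = suc j} e = cong suc (off-image inv e)

-- The zones differ: along `ρ` only lookups must agree, since unrestricted variables may be merged
-- or ignored, whereas the linear context is pulled back exactly. Each rule follows from `pull`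
-- preserving `∅`, singletons and unions.
rename-⊢ : ∀ {ρ : Fin m → Fin m′} {σ : Fin n → Fin n′} {τ Δ′} {t : Tm m n} {A} →
           (∀ u → lookup Δ′ (ρ u) ≡ lookup Δ u) → σ ⁻¹≗ τ →
           Δ ⨾ Γ ⊢ t ∶ A → Δ′ ⨾ pull τ Γ ⊢ rename ρ σ t ∶ A
rename-⊢ e i (lvar a)        = castCtx (sym (pull-↦ i a)) (lvar _)
rename-⊢ {τ = τ} e i (uvar u eq) = castCtx (sym (pull-∅ τ)) (uvar _ (trans (e u) eq))
rename-⊢ {τ = τ} e i (⊗-intro p d₁ d₂) = ⊗-intro (pull-⊎ τ p) (rename-⊢ e i d₁) (rename-⊢ e i d₂)
rename-⊢ {τ = τ} e i (⊗-elim {Γ′ = Γ′} p d₁ d₂) =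
  ⊗-elim (pull-⊎ τ p) (rename-⊢ e i d₁)
    (castCtx (pull-lift₂ᵖ τ Γ′)
      (rename-⊢ e (lift₂-⁻¹≗ i) d₂))
rename-⊢ {τ = τ} e i (⅋-intro {Γ = Γ} d) =
  ⅋-intro
    (castCtx (pull-lift₂ᵖ τ Γ)
      (rename-⊢ e (lift₂-⁻¹≗ i) d))
rename-⊢ {τ = τ} e i (⅋-elim₁ p d₁ d₂) = ⅋-elim₁ (pull-⊎ τ p) (rename-⊢ e i d₁) (rename-⊢ e i d₂)
rename-⊢ {τ = τ} e i (⅋-elim₂ p d₁ d₂) = ⅋-elim₂ (pull-⊎ τ p) (rename-⊢ e i d₁) (rename-⊢ e i d₂)
rename-⊢ {τ = τ} e i (!-intro d) =
  castCtx (sym (pull-∅ τ))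
    (!-intro (castCtx (trans (pull-liftᵖ τ ∅) (cong (_ ∷_) (pull-∅ τ))) (rename-⊢ e (lift-⁻¹≗ i) d)))
rename-⊢ {τ = τ} e i (!-elim p d₁ d₂) =
  !-elim (pull-⊎ τ p) (rename-⊢ e i d₁) (rename-⊢ (lift-lookup e) i d₂)
rename-⊢ e i (?-intro d)     = ?-intro (rename-⊢ (lift-lookup e) i d)
rename-⊢ {τ = τ} e i (?-elim d₁ d₂) =
  ?-elim (rename-⊢ e i d₁)
    (castCtx (trans (pull-liftᵖ τ ∅) (cong (_ ∷_) (pull-∅ τ))) (rename-⊢ e (lift-⁻¹≗ i) d₂))
rename-⊢ {τ = τ} e i (cut p d₁ d₂)    = cut (pull-⊎ τ p) (rename-⊢ e i d₁) (rename-⊢ e i d₂)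
rename-⊢ {τ = τ} e i 𝟏-intro          = castCtx (sym (pull-∅ τ)) 𝟏-intro
rename-⊢ {τ = τ} e i (𝟏-elim p d₁ d₂) = 𝟏-elim (pull-⊎ τ p) (rename-⊢ e i d₁) (rename-⊢ e i d₂)

weakenL₁-⊢ : ∀ {t : Tm m n} {A} → Δ ⨾ Γ ⊢ t ∶ A → Δ ⨾ nothing ∷ Γ ⊢ weakenL 1 t ∶ A
weakenL₁-⊢ {Γ = Γ} d =
  -- Past the new index, pulling back along `skipᵖ just` is `tabulate (lookup Γ)`.
  castCtx (cong (nothing ∷_) (tabulate∘lookup Γ)) (rename-⊢ (λ _ → refl) (suc-⁻¹≗ id-⁻¹≗) d)

weakenL₂-⊢ : ∀ {t : Tm m n} {A} → Δ ⨾ Γ ⊢ t ∶ A → Δ ⨾ nothing ∷ nothing ∷ Γ ⊢ weakenL 2 t ∶ A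
weakenL₂-⊢ {Γ = Γ} d =
  castCtx (cong (λ Γ → nothing ∷ nothing ∷ Γ) (tabulate∘lookup Γ))
    (rename-⊢ (λ _ → refl) (suc-⁻¹≗ (suc-⁻¹≗ id-⁻¹≗)) d)

weakenU-⊢ : ∀ {t : Tm m n} {A B} → Δ ⨾ Γ ⊢ t ∶ A → B ∷ Δ ⨾ Γ ⊢ weakenU t ∶ A
weakenU-⊢ {Γ = Γ} d = castCtx (tabulate∘lookup Γ) (rename-⊢ (λ _ → refl) id-⁻¹≗ d)

-- In the translation of `ƛ M` the bound variable stays at index 0 and the fresh `k` enters at index
-- 1.
punchIn₁-⊢ : ∀ {t : Tm m (suc n)} {A} → Δ ⨾ x ∷ Γ ⊢ t ∶ A →
             Δ ⨾ x ∷ nothing ∷ Γ ⊢ rename id (punchIn (suc zero)) t ∶ A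
punchIn₁-⊢ {Γ = Γ} d =
  castCtx (trans (pull-liftᵖ (skipᵖ just) Γ) (cong (λ Γ → _ ∷ nothing ∷ Γ) (tabulate∘lookup Γ)))
    (rename-⊢ (λ _ → refl) (⁻¹≗-resp-≗ pointwise (lift-⁻¹≗ (suc-⁻¹≗ id-⁻¹≗))) d)
  where
  pointwise : lift 1 suc ≗ punchIn (suc zero)
  pointwise zero    = refl
  pointwise (suc i) = refl

unfocus : ∀ l → Fin (suc (l + k)) → Fin (l + suc k)
unfocus l zero    = l ↑ʳ zero
unfocus {k} l (suc j) = [ _↑ˡ suc k , (l ↑ʳ_) ∘ suc ]′ (splitAt l j)

focus-⁻¹≗ : ∀ l → focus {k} l ⁻¹≗ (just ∘ unfocus l)
focus-⁻¹≗ {k} l .on-image i with splitAt l i in eq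
... | inj₁ x rewrite splitAt-↑ˡ l x k = cong just (splitAt⁻¹-↑ˡ eq)
... | inj₂ zero                       = cong just (splitAt⁻¹-↑ʳ eq)
... | inj₂ (suc y) rewrite splitAt-↑ʳ l k y = cong just (splitAt⁻¹-↑ʳ eq)
focus-⁻¹≗ {k} l .off-image {j = zero} refl rewrite splitAt-↑ʳ l (suc k) zero = refl
focus-⁻¹≗ {k} l .off-image {j = suc j} refl with splitAt l j in eq
... | inj₁ x rewrite splitAt-↑ˡ l x (suc k)       = cong suc (splitAt⁻¹-↑ˡ eq)
... | inj₂ y rewrite splitAt-↑ʳ l (suc k) (suc y) = cong suc (splitAt⁻¹-↑ʳ eq)

-- The continuation bound by `μ` sits between the linear and the continuation zone; moved to the
-- head, it can be contra-substituted with evidence `here`.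
focus-⊢ : ∀ (Γ : PCtx Formula l) {Σ : PCtx Formula k} {t : Tm m (l + suc k)} {A} →
          Δ ⨾ Γ ++ x ∷ Σ ⊢ t ∶ A → Δ ⨾ x ∷ (Γ ++ Σ) ⊢ rename id (focus l) t ∶ A
focus-⊢ {l = l} {k = k} {x = x} Γ {Σ} d =
  castCtx (cong₂ _∷_ (lookup-++ʳ Γ (x ∷ Σ) zero)
                     (trans (tabulate-cong pointwise) (tabulate∘lookup (Γ ++ Σ))))
    (rename-⊢ (λ _ → refl) (focus-⁻¹≗ l) d)
  where
  pointwise : ∀ j → lookup (Γ ++ x ∷ Σ) (unfocus l (suc j)) ≡ lookup (Γ ++ Σ) j
  pointwise j rewrite lookup-splitAt l Γ Σ j with splitAt l j
  ... | inj₁ i = lookup-++ˡ Γ (x ∷ Σ) i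
  ... | inj₂ i = lookup-++ʳ Γ (x ∷ Σ) (suc i)

-- Partial results: `Any P` asserts definedness together with `P`.

any-map : {P : X → Set} {Q : Y → Set} {f : X → Y} →
          (∀ {a} → P a → Q (f a)) → Any P x → Any Q (Maybe.map f x)
any-map g (just p) = just (g p)

any-zipWith : ∀ {Z : Set} {P : X → Set} {Q : Y → Set} {R : Z → Set} {f : X → Y → Z} →
              (∀ {a b} → P a → Q b → R (f a b)) → Any P x → Any Q y → Any R (zipWith f x y)
any-zipWith g (just p) (just q) = just (g p q)

any->>= : {P : X → Set} {Q : Y → Set} {f : X → Maybe Y} →
          Any P x → (∀ {a} → P a → Any Q (f a)) → Any Q (x >>= f)
any->>= (just p) g = g p

any-<∣>ˡ : {P : X → Set} {x y : Maybe X} → Any P x → Any P (x <∣> y)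
any-<∣>ˡ (just p) = just p

-- The first alternative of a contra-substitution clause begins by strengthening the other subterm;
-- when `a` occurs there, that step fails and the second alternative is taken.
any->>=-<∣>ʳ : {P : Y → Set} {f : X → Maybe Y} {y : Maybe Y} →
               x ≡ nothing → Any P y → Any P ((x >>= f) <∣> y)
any->>=-<∣>ʳ refl p = p

map-nothing : {f : X → Y} → x ≡ nothing → Maybe.map f x ≡ nothing
map-nothing refl = refl

zipWith-nothingˡ : ∀ {Z : Set} {f : X → Y → Z} → x ≡ nothing → zipWith f x y ≡ nothing
zipWith-nothingˡ refl = refl

zipWith-nothingʳ : ∀ {Z : Set} {f : X → Y → Z} → y ≡ nothing → zipWith f x y ≡ nothing
zipWith-nothingʳ {x = nothing} refl = refl
zipWith-nothingʳ {x = just _}  refl = refl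

-- Strengthening of typed terms.

-- An absent entry can only split as `none`, so both premises of a rule lack `a` again, down to the
-- leaves.
strengthen-⊢ : ∀ {a : Fin (suc n)} {t : Tm m (suc n)} {A} →
               Insert a nothing Γ Θ → Δ ⨾ Θ ⊢ t ∶ A → Any (Δ ⨾ Γ ⊢_∶ A) (strengthen a t)
strengthen-⊢ {a = a} i (lvar b) with a ≟ b
... | yes refl with () , _ ← insert-↦⁻¹ a i
... | no a≢b with _ , refl ← insert-↦-≢⁻¹ a b a≢b i = just (lvar _)
strengthen-⊢ i (uvar u eq) with _ , refl ← insert-∅⁻¹ i = just (uvar u eq)
strengthen-⊢ i (⊗-intro p d₁ d₂) with _ , _ , _ , _ , i₁ , i₂ , none q ← insert-⊎⁻¹ i p =
  any-zipWith (⊗-intro q) (strengthen-⊢ i₁ d₁) (strengthen-⊢ i₂ d₂)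
strengthen-⊢ i (⊗-elim p d₁ d₂) with _ , _ , _ , _ , i₁ , i₂ , none q ← insert-⊎⁻¹ i p =
  any-zipWith (λ e₂ e₁ → ⊗-elim q e₁ e₂) (strengthen-⊢ (there (there i₂)) d₂) (strengthen-⊢ i₁ d₁)
strengthen-⊢ i (⅋-intro d) = any-map ⅋-intro (strengthen-⊢ (there (there i)) d)
strengthen-⊢ i (⅋-elim₁ p d₁ d₂) with _ , _ , _ , _ , i₁ , i₂ , none q ← insert-⊎⁻¹ i p =
  any-zipWith (⅋-elim₁ q) (strengthen-⊢ i₁ d₁) (strengthen-⊢ i₂ d₂)
strengthen-⊢ i (⅋-elim₂ p d₁ d₂) with _ , _ , _ , _ , i₁ , i₂ , none q ← insert-⊎⁻¹ i p =
  any-zipWith (⅋-elim₂ q) (strengthen-⊢ i₁ d₁) (strengthen-⊢ i₂ d₂)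
strengthen-⊢ i (!-intro d) with _ , refl ← insert-∅⁻¹ i =
  any-map !-intro (strengthen-⊢ (there i) d)
strengthen-⊢ i (!-elim p d₁ d₂) with _ , _ , _ , _ , i₁ , i₂ , none q ← insert-⊎⁻¹ i p =
  any-zipWith (λ e₂ e₁ → !-elim q e₁ e₂) (strengthen-⊢ i₂ d₂) (strengthen-⊢ i₁ d₁)
strengthen-⊢ i (?-intro d) = any-map ?-intro (strengthen-⊢ i d)
strengthen-⊢ {a = a} i (?-elim d₁ d₂) =
  -- The rule types the body in `just A ∷ ∅`, so the absence of `a` there comes from `insert-∅`, not
  -- from `i`.
  any-zipWith (λ e₂ e₁ → ?-elim e₁ e₂) (strengthen-⊢ (there (insert-∅ a)) d₂) (strengthen-⊢ i d₁)
strengthen-⊢ i (cut p d₁ d₂) with _ , _ , _ , _ , i₁ , i₂ , none q ← insert-⊎⁻¹ i p =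
  any-zipWith (cut q) (strengthen-⊢ i₁ d₁) (strengthen-⊢ i₂ d₂)
strengthen-⊢ i 𝟏-intro with _ , refl ← insert-∅⁻¹ i = just 𝟏-intro
strengthen-⊢ i (𝟏-elim p d₁ d₂) with _ , _ , _ , _ , i₁ , i₂ , none q ← insert-⊎⁻¹ i p =
  any-zipWith (λ e₂ e₁ → 𝟏-elim q e₁ e₂) (strengthen-⊢ i₂ d₂) (strengthen-⊢ i₁ d₁)

-- By linearity exactly one premise inherits the entry at `a`, and its failure propagates through
-- `zipWith`.
strengthen-nothing : ∀ {a : Fin (suc n)} {t : Tm m (suc n)} {A B} →
                     Insert a (just A) Γ Θ → Δ ⨾ Θ ⊢ t ∶ B → strengthen a t ≡ nothing
strengthen-nothing {a = a} i (lvar b) with a ≟ b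
... | yes _ = refl
... | no a≢b with () , _ ← insert-↦-≢⁻¹ a b a≢b i
strengthen-nothing i (uvar u eq) with () , _ ← insert-∅⁻¹ i
strengthen-nothing i (⊗-intro p d₁ d₂) with insert-⊎⁻¹ i p
... | _ , _ , _ , _ , i₁ , _ , left _  = zipWith-nothingˡ (strengthen-nothing i₁ d₁)
... | _ , _ , _ , _ , _ , i₂ , right _ = zipWith-nothingʳ (strengthen-nothing i₂ d₂)
strengthen-nothing i (⊗-elim p d₁ d₂) with insert-⊎⁻¹ i p
... | _ , _ , _ , _ , i₁ , _ , left _  = zipWith-nothingʳ (strengthen-nothing i₁ d₁)
... | _ , _ , _ , _ , _ , i₂ , right _ = zipWith-nothingˡ (strengthen-nothing (there (there i₂)) d₂)
strengthen-nothing i (⅋-intro d) = map-nothing (strengthen-nothing (there (there i)) d)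
strengthen-nothing i (⅋-elim₁ p d₁ d₂) with insert-⊎⁻¹ i p
... | _ , _ , _ , _ , i₁ , _ , left _  = zipWith-nothingˡ (strengthen-nothing i₁ d₁)
... | _ , _ , _ , _ , _ , i₂ , right _ = zipWith-nothingʳ (strengthen-nothing i₂ d₂)
strengthen-nothing i (⅋-elim₂ p d₁ d₂) with insert-⊎⁻¹ i p
... | _ , _ , _ , _ , i₁ , _ , left _  = zipWith-nothingˡ (strengthen-nothing i₁ d₁)
... | _ , _ , _ , _ , _ , i₂ , right _ = zipWith-nothingʳ (strengthen-nothing i₂ d₂)
strengthen-nothing i (!-intro d) with () , _ ← insert-∅⁻¹ i
strengthen-nothing i (!-elim p d₁ d₂) with insert-⊎⁻¹ i p
... | _ , _ , _ , _ , i₁ , _ , left _  = zipWith-nothingʳ (strengthen-nothing i₁ d₁)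
... | _ , _ , _ , _ , _ , i₂ , right _ = zipWith-nothingˡ (strengthen-nothing i₂ d₂)
strengthen-nothing i (?-intro d) = map-nothing (strengthen-nothing i d)
strengthen-nothing i (?-elim d₁ d₂) = zipWith-nothingʳ (strengthen-nothing i d₁)
strengthen-nothing i (cut p d₁ d₂) with insert-⊎⁻¹ i p
... | _ , _ , _ , _ , i₁ , _ , left _  = zipWith-nothingˡ (strengthen-nothing i₁ d₁)
... | _ , _ , _ , _ , _ , i₂ , right _ = zipWith-nothingʳ (strengthen-nothing i₂ d₂)
strengthen-nothing i 𝟏-intro with () , _ ← insert-∅⁻¹ i
strengthen-nothing i (𝟏-elim p d₁ d₂) with insert-⊎⁻¹ i p
... | _ , _ , _ , _ , i₁ , _ , left _  = zipWith-nothingʳ (strengthen-nothing i₁ d₁)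
... | _ , _ , _ , _ , _ , i₂ , right _ = zipWith-nothingˡ (strengthen-nothing i₂ d₂)

-- Typing of contra-substitution.

contra-⊢ : ∀ {Γs : PCtx Formula n} {a} {t : Tm m (suc n)} {s A B} →
           Insert a (just A) Γ Θ → Δ ⨾ Θ ⊢ t ∶ B →
           Γ ⊎ Γs ≋ Ξ → Δ ⨾ Γs ⊢ s ∶ B ^⊥ →
           Any (Δ ⨾ Ξ ⊢_∶ A ^⊥) (t ⟪ a ⑊ s ⟫)
contra-⊢ {a = a} i (lvar b) p ds with a ≟ b
... | no a≢b with () , _ ← insert-↦-≢⁻¹ a b a≢b i
... | yes refl with refl , refl ← insert-↦⁻¹ a i = just (castCtx (⊎-identityˡ⁻¹ p) ds)
contra-⊢ i (uvar u eq) p ds with () , _ ← insert-∅⁻¹ i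
contra-⊢ i (⊗-intro p d₁ d₂) ps ds with insert-⊎⁻¹ i p
... | _ , _ , _ , _ , i₁ , i₂ , left q =
  let _ , q₂ , q₁ = ⊎-assoc q ps in
  any-<∣>ˡ (any->>= (strengthen-⊢ i₂ d₂) λ e₂ →
    -- `ds` is a typing at a par of two duals, so the argument of `▾` must be typed by a double
    -- negation.
    contra-⊢ i₁ d₁ q₁ (⅋-elim₂ (⊎-comm q₂) ds (^⊥^⊥-intro e₂)))
... | _ , _ , _ , _ , i₁ , i₂ , right q =
  let _ , q₁ , q₂ = ⊎-assoc (⊎-comm q) ps in
  any->>=-<∣>ʳ (strengthen-nothing i₂ d₂) (any->>= (strengthen-⊢ i₁ d₁) λ e₁ →
    contra-⊢ i₂ d₂ q₂ (⅋-elim₁ (⊎-comm q₁) ds (^⊥^⊥-intro e₁)))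
contra-⊢ i (⅋-elim₁ p d₁ d₂) ps ds with insert-⊎⁻¹ i p
... | _ , _ , _ , _ , i₁ , i₂ , left q =
  let _ , q₂ , q₁ = ⊎-assoc q ps in
  any-<∣>ˡ (any->>= (strengthen-⊢ i₂ d₂) λ e₂ →
    contra-⊢ i₁ d₁ q₁ (⊗-intro q₂ e₂ ds))
... | _ , _ , _ , _ , i₁ , i₂ , right q =
  let _ , q₁ , q₂ = ⊎-assoc (⊎-comm q) ps in
  any->>=-<∣>ʳ (strengthen-nothing i₂ d₂) (any->>= (strengthen-⊢ i₁ d₁) λ e₁ →
    contra-⊢ i₂ d₂ q₂ (^⊥^⊥-intro (⅋-elim₂ q₁ e₁ ds)))
contra-⊢ i (⅋-elim₂ p d₁ d₂) ps ds with insert-⊎⁻¹ i p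
... | _ , _ , _ , _ , i₁ , i₂ , left q =
  let _ , q₂ , q₁ = ⊎-assoc q ps in
  any-<∣>ˡ (any->>= (strengthen-⊢ i₂ d₂) λ e₂ →
    contra-⊢ i₁ d₁ q₁ (⊗-intro (⊎-comm q₂) ds e₂))
... | _ , _ , _ , _ , i₁ , i₂ , right q =
  let _ , q₁ , q₂ = ⊎-assoc (⊎-comm q) ps in
  any->>=-<∣>ʳ (strengthen-nothing i₂ d₂) (any->>= (strengthen-⊢ i₁ d₁) λ e₁ →
    contra-⊢ i₂ d₂ q₂ (^⊥^⊥-intro (⅋-elim₁ q₁ e₁ ds)))
contra-⊢ i (⊗-elim p d₂ d₁) ps ds with insert-⊎⁻¹ i p
-- The rule lists the eliminated term first, so `right` means that `a` is in the body. Then `s`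
-- moves under the binder.
... | _ , _ , _ , _ , i₂ , i₁ , right q =
  let _ , q₁ , q₂ = ⊎-assoc q ps in
  any-<∣>ˡ (any->>= (strengthen-⊢ i₂ d₂) λ e₂ →
    any->>= (contra-⊢ (there (there i₁)) d₁ (left (left q₁)) (weakenL₂-⊢ ds)) λ e₁ → just (⊗-elim q₂ e₂ e₁))
... | _ , _ , _ , _ , i₂ , i₁ , left q =
  let _ , q₁ , q₂ = ⊎-assoc q ps in
  any->>=-<∣>ʳ (strengthen-nothing i₂ d₂) (any->>= (strengthen-⊢ (there (there i₁)) d₁) λ e₁ →
    contra-⊢ i₂ d₂ q₂ (⅋-intro (cut (left (left q₁)) e₁ (weakenL₂-⊢ ds))))
contra-⊢ i (⅋-intro d) ps ds =
  -- The body has type `⊥`, whose dual is `𝟏`, so the closed term `⋆` is passed inwards while `s` is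
  -- eliminated outside.
  any->>= (contra-⊢ (there (there i)) d (⊎-identityʳ _) 𝟏-intro) λ e →
    just (⊗-elim (⊎-comm ps) (cast (cong₂ _⊗_ (^⊥-involutive _) (^⊥-involutive _)) ds) e)
contra-⊢ i (!-intro d) ps ds with () , _ ← insert-∅⁻¹ i
contra-⊢ i (!-elim p d₂ d₁) ps ds with insert-⊎⁻¹ i p
... | _ , _ , _ , _ , i₂ , i₁ , right q =
  let _ , q₁ , q₂ = ⊎-assoc q ps in
  any-<∣>ˡ (any->>= (strengthen-⊢ i₂ d₂) λ e₂ →
    any->>= (contra-⊢ i₁ d₁ q₁ (weakenU-⊢ ds)) λ e₁ → just (!-elim q₂ e₂ e₁))
... | _ , _ , _ , _ , i₂ , i₁ , left q =
  let _ , q₁ , q₂ = ⊎-assoc q ps in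
  any->>=-<∣>ʳ (strengthen-nothing i₂ d₂) (any->>= (strengthen-⊢ i₁ d₁) λ e₁ →
    -- The dual of `! A` is `⁇ (A ^⊥)`, so `?-intro` binds its variable at `A ^⊥ ^⊥`.
    contra-⊢ i₂ d₂ q₂ (?-intro (cut q₁ (hyp-^⊥^⊥-intro e₁) (weakenU-⊢ ds))))
contra-⊢ i (?-intro d) ps ds =
  any->>= (contra-⊢ i d (⊎-identityʳ _) 𝟏-intro) λ e → just (!-elim (⊎-comm ps) ds e)
contra-⊢ {a = a} i (?-elim d₂ d₁) ps ds =
  any->>= (strengthen-⊢ (there (insert-∅ a)) d₁) λ e₁ →
  -- The promotion has type `! (A ^⊥)`, by definition the dual of `⁇ A`, and an empty linear
  -- context. The original `s` has type `𝟏` and is consumed by `𝟏-elim`.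
  any->>= (contra-⊢ i d₂ (⊎-identityʳ _) (!-intro e₁)) λ e₂ →
    just (𝟏-elim (⊎-comm ps) ds e₂)
contra-⊢ i (cut p d₁ d₂) ps ds with insert-⊎⁻¹ i p
... | _ , _ , _ , _ , i₁ , i₂ , left q =
  -- The other side of the cut already has the dual type and becomes the argument, so `q` itself
  -- splits the resources; `s` is again consumed by `𝟏-elim`.
  any-<∣>ˡ (any->>= (strengthen-⊢ i₂ d₂) λ e₂ →
    any->>= (contra-⊢ i₁ d₁ q e₂) λ e → just (𝟏-elim (⊎-comm ps) ds e))
... | _ , _ , _ , _ , i₁ , i₂ , right q =
  any->>=-<∣>ʳ (strengthen-nothing i₂ d₂) (any->>= (strengthen-⊢ i₁ d₁) λ e₁ →
    any->>= (contra-⊢ i₂ d₂ (⊎-comm q) (^⊥^⊥-intro e₁)) λ e → just (𝟏-elim (⊎-comm ps) ds e))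
contra-⊢ i 𝟏-intro ps ds with () , _ ← insert-∅⁻¹ i
contra-⊢ i (𝟏-elim p d₂ d₁) ps ds with insert-⊎⁻¹ i p
... | _ , _ , _ , _ , i₂ , i₁ , right q =
  let _ , q₁ , q₂ = ⊎-assoc q ps in
  any-<∣>ˡ (any->>= (strengthen-⊢ i₂ d₂) λ e₂ →
    any->>= (contra-⊢ i₁ d₁ q₁ ds) λ e₁ → just (𝟏-elim q₂ e₂ e₁))
... | _ , _ , _ , _ , i₂ , i₁ , left q =
  let _ , q₁ , q₂ = ⊎-assoc q ps in
  any->>=-<∣>ʳ (strengthen-nothing i₂ d₂) (any->>= (strengthen-⊢ i₁ d₁) λ e₁ →
    contra-⊢ i₂ d₂ q₂ (cut q₁ e₁ ds))

-- Type preservation of the translation.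

ᴴ-∅ : ∀ l → mapCtx _ᴴ (∅ {n = l}) ++ mapCtx (λ B → B ᴴ ^⊥) (∅ {n = k}) ≡ ∅
ᴴ-∅ l = trans (cong₂ _++_ (map-∅ {n = l} _ᴴ) (map-∅ _)) (∅-++ l)

translate-⊢ : ∀ {m l k} {Δ : Vec Type m} {Γ : PCtx Type l} {Σ : PCtx Type k} {M : Term m l k} {A : Type} →
  Δ ⨾ Γ ⊢ M ∶ A ∣ Σ →
  Any (map _ᴴ Δ ⨾ mapCtx _ᴴ Γ ++ mapCtx (λ B → B ᴴ ^⊥) Σ ⊢_∶ A ᴴ) (M ᴴᵗ)
translate-⊢ (lvar x) = just (castCtx (sym (trans (cong₂ _++_ (map-↦ _ x) (map-∅ _)) (↦-++-∅ x))) (lvar _))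
translate-⊢ {l = l} {Δ = Δ} (uvar u eq) =
  just (castCtx (sym (ᴴ-∅ l)) (uvar u (trans (lookup-map u _ᴴ Δ) (cong _ᴴ eq))))
translate-⊢ (Λ_ {B = B} d) = any->>= (translate-⊢ d) λ e →
  -- `k` has type `B ᴴ ^⊥`, so the right component comes out doubly negated; the left one, the dual
  -- of `! (A ᴴ)`, is right by computation.
  just (cast (cong (_ ⅋_) (^⊥-involutive (B ᴴ)))
    (⅋-intro (cut (left (right (⊎-identityʳ _)))
      (!-elim (left (none (⊎-comm (⊎-identityʳ _)))) (lvar zero) (weakenL₂-⊢ e)) (lvar (suc zero)))))
translate-⊢ {l = l} (d₁ ＠ d₂) =
  any->>= (translate-⊢ d₁) λ e₁ →
  any->>= (translate-⊢ d₂) λ e₂ →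
    -- `N` is typed without linear or continuation variables, so promotion applies. With its
    -- variable at `A ᴴ ^⊥` it gets type `! (A ᴴ ^⊥ ^⊥)`, the dual of `⁇ (A ᴴ ^⊥)` by computation.
    just (⅋-elim₁ (⊎-identityʳ _) e₁
      (!-intro (cut (right (⊎-identityʳ _)) (weakenL₁-⊢ (castCtx (ᴴ-∅ l) e₂)) (lvar zero))))
translate-⊢ (ƛ_ {B = B} d) = any->>= (translate-⊢ d) λ e →
  just (cast (cong (_ ⅋_) (^⊥-involutive (B ᴴ)))
    (⅋-intro (cut (left (right (⊎-identityʳ _))) (punchIn₁-⊢ e) (lvar (suc zero)))))
translate-⊢ (app p q d₁ d₂) =
  any->>= (translate-⊢ d₁) λ e₁ →
  any->>= (translate-⊢ d₂) λ e₂ →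
    just (⅋-elim₁ (⊎-++ (⊎-map _ p) (⊎-map _ q)) e₁ (^⊥^⊥-intro e₂))
translate-⊢ {l = l} {Γ = Γ} (name γ p d) = any->>= (translate-⊢ d) λ e →
  just (cut (⊎-++ (⊎-identityʳ (mapCtx _ᴴ Γ)) (⊎-map _ p)) e
    (castCtx (sym (trans (cong (∅ {n = l} ++_) (map-↦ _ γ)) (∅-++-↦ l γ))) (lvar _)))
translate-⊢ {Γ = Γ} (μ_ {A = A} d) = any->>= (translate-⊢ d) λ e →
  -- The continuation is typed by `A ᴴ ^⊥`, so contra-substitution returns a term of type
  -- `A ᴴ ^⊥ ^⊥`.
  subst (λ F → Any (_ ⨾ _ ⊢_∶ F) _) (^⊥-involutive (A ᴴ))
    (contra-⊢ here (focus-⊢ (mapCtx _ᴴ Γ) e) (⊎-identityʳ _) 𝟏-intro)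

lemma85 : ∀ {m l k : ℕ} {Δ : Vec Type m} {Γ : PCtx Type l} {Σ : PCtx Type k} {M : Term m l k} {A : Type} →
    Δ ⨾ Γ ⊢ M ∶ A ∣ Σ →
    ∃[ t ] (M ᴴᵗ ≡ just t) ×
    (map _ᴴ Δ ⨾ mapCtx _ᴴ Γ ++ mapCtx (λ B → B ᴴ ^⊥) Σ ⊢ t ∶ A ᴴ)
lemma85 {M = M} d with M ᴴᵗ | translate-⊢ d
... | just t | just e = t , refl , e
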